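{- If $c\geq 2$ and $k\geq 1$, then $\mathit{fw}(I_{c}^{k}D_{c})=c+2k-1$.
   Context: A sequence $s$ contains a sequence $u$ if some subsequence of $s$ can be changed into $u$ by a one-to-one renaming of its letters. An $(r,s)$-formation is a concatenation of $s$ permutations of the same set of $r$ distinct letters. The formation width $\mathit{fw}(u)$ is the minimum $s$ such that there exists $r$ for which every $(r,s)$-formation contains $u$. $I_c$ denotes $1\,2\ldots c$, $D_c$ denotes $c\,(c-1)\ldots 1$, and $I_c^k$ is $I_c$ concatenated $k$ times. -}

module Defs where

open import Data.Nat using (ℕ; suc; _<_)
open import Data.List using (List; map; concat; replicate; reverse; length; applyUpTo; _++_)
open import Data.List.Membership.Propositional using (_∈_)
open import Data.List.Relation.Unary.All using (All)
open import Data.List.Relation.Unary.Unique.Propositional using (Unique)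
open import Data.List.Relation.Binary.Sublist.Propositional using (_⊆_)
open import Data.List.Relation.Binary.Permutation.Propositional using (_↭_)
open import Data.Product using (Σ; ∃; _×_)
open import Relation.Binary.PropositionalEquality using (_≡_)
open import Relation.Nullary using (¬_)

Seq : Set
Seq = List ℕ

Contains : Seq → Seq → Set
Contains s u = Σ Seq λ t → (t ⊆ s) × Σ (ℕ → ℕ) λ f →
  ((∀ {x y} → x ∈ t → y ∈ t → f x ≡ f y → x ≡ y) × map f t ≡ u)

IsFormation : ℕ → ℕ → Seq → Set
IsFormation r s w = Σ Seq λ L → Unique L × length L ≡ r ×
  Σ (List Seq) λ blocks → length blocks ≡ s × All (_↭ L) blocks × w ≡ concat blocks

FormationForces : Seq → ℕ → Set
FormationForces u s = ∃ λ r → ∀ w → IsFormation r s w → Contains w u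

FwEq : Seq → ℕ → Set
FwEq u m = FormationForces u m × (∀ s → s < m → ¬ FormationForces u s)

I : ℕ → Seq
I c = applyUpTo suc c

D : ℕ → Seq
D c = reverse (I c)

Ipow : ℕ → ℕ → Seq
Ipow c k = concat (replicate k (I c))

{-# OPTIONS --safe #-}
module Submission where

-- Upper bound.  Iterating Erdős–Szekeres over the blocks gives, in every formation on enough letters, a list M
-- of c letters such that each block contains M or reverse M.  Among the first 2k − 1 blocks, k agree; they contain
-- π^k for π = M or π = reverse M, and each of the c remaining blocks supplies one letter of reverse π.
--
-- Lower bound.  With U increasing and V decreasing, the formation (U V)^(k−1) U^c has c + 2k − 2 blocks.  Let
-- π^k (reverse π) embed in it, where π starts with a b.  Each earlier copy of a b uses up two blocks, so
-- π (reverse π) embeds in U^c (if a > b) or, but for its first letter, in U^c (if a < b; the first letter a may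
-- lie in the last V).  Both words have exactly c non-ascents, and every non-ascent forces a new block U, so U^c is
-- too short.

open import Defs
open import Data.Nat using (ℕ; zero; suc; _≤_; _<_; _>_; _+_; _*_; _∸_; z≤n; s≤s; _<?_; _≟_)
open import Data.Nat.Properties
  using (+-suc; +-comm; +-assoc; +-identityʳ; ≤-reflexive; ≤-trans; ≤-pred; ≤-antisym; ≮⇒≥; m≤n+m; n≮n; <-asym;
    <-cmp; suc-injective; <⇒≢; m≤n⇒m⊓n≡m)
open import Data.List
  using (List; []; _∷_; _++_; map; concat; replicate; reverse; length; take; drop; upTo; downFrom)
open import Data.List.Properties
  using (++-assoc; map-++; concat-map; map-replicate; reverse-map; unfold-reverse; reverse-involutive; length-reverse;
    length-applyUpTo; length-replicate; length-map; map-cong-local; ∷-injectiveˡ; ∷-injectiveʳ; length-upTo;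
    length-take; take++drop≡id; concat-++; reverse-upTo; ++-identityʳ)
open import Data.List.Membership.Propositional using (_∈_)
open import Data.List.Membership.Propositional.Properties using (∈-++⁻; ∈-++⁺ˡ; ∈-∃++)
open import Data.List.Relation.Unary.All as All using (All; []; _∷_)
import Data.List.Relation.Unary.All.Properties as All
open import Data.List.Relation.Unary.Any using (here; there)
open import Data.List.Relation.Unary.AllPairs using (AllPairs; []; _∷_)
import Data.List.Relation.Unary.AllPairs.Properties as AllPairs
open import Data.List.Relation.Unary.Unique.Propositional using (Unique)
import Data.List.Relation.Unary.Unique.Propositional.Properties as Unique
open import Data.List.Relation.Binary.Sublist.Propositional
  using (_⊆_; []; _∷_; _∷ʳ_; minimum; ⊆-refl; ⊆-trans; ⊆-reflexive; from∈)
open import Data.List.Relation.Binary.Sublist.Propositional.Properties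
  using (All-resp-⊆; Any-resp-⊆; ++⁺; ++⁺ˡ; ++⁺ʳ; ∷ˡ⁻; reverse⁺)
open import Data.List.Relation.Binary.Permutation.Propositional using (_↭_; ↭⇒↭ₛ; ↭-refl; ↭-sym; ↭-reflexive; ↭-trans)
open import Data.List.Relation.Binary.Permutation.Propositional.Properties using (All-resp-↭; ∈-resp-↭; ↭-reverse; ↭-length)
open import Data.Product using (∃; _×_; _,_)
open import Data.Sum as Sum using (_⊎_; inj₁; inj₂)
open import Function using (_∘_; id)
open import Relation.Nullary using (¬_; yes; no; contradiction)
open import Relation.Binary.Definitions using (tri<; tri≈; tri>)
open import Relation.Binary.PropositionalEquality using (_≡_; _≢_; refl; sym; trans; cong; cong₂; subst; setoid;
    module ≡-Reasoning)
open import Data.List.Relation.Binary.Permutation.Setoid.Properties (setoid ℕ) using (Unique-resp-↭)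

private
  variable
    A : Set

-- Sublists, and words consisting of copies of a list and one reversal

AllPairs-resp-⊇ : ∀ {R : A → A → Set} {xs ys} → xs ⊆ ys → AllPairs R ys → AllPairs R xs
AllPairs-resp-⊇ []         []         = []
AllPairs-resp-⊇ (y ∷ʳ τ)   (_ ∷ rys)  = AllPairs-resp-⊇ τ rys
AllPairs-resp-⊇ (refl ∷ τ) (ry ∷ rys) = All-resp-⊆ τ ry ∷ AllPairs-resp-⊇ τ rys

-- `word k (I c)` unfolds to `Ipow c k ++ D c`.
word : {A : Set} → ℕ → List A → List A
word k π = concat (replicate k π) ++ reverse π

map-word : ∀ {B : Set} (f : A → B) k π → map f (word k π) ≡ word k (map f π)
map-word f k π = begin
  map f (concat (replicate k π) ++ reverse π)         ≡⟨ map-++ f (concat (replicate k π)) (reverse π) ⟩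
  map f (concat (replicate k π)) ++ map f (reverse π) ≡⟨ cong₂ _++_ (sym (concat-map (replicate k π))) (reverse-map f π) ⟩
  concat (map (map f) (replicate k π)) ++ reverse (map f π)
    ≡⟨ cong (λ xss → concat xss ++ reverse (map f π)) (map-replicate (map f) k π) ⟩
  word k (map f π) ∎
  where open ≡-Reasoning

All-word : ∀ {P : A → Set} k {π} → All P π → All P (word k π)
All-word k {π} pπ = All.++⁺ (All.concat⁺ (All.replicate⁺ k pπ)) (All-resp-↭ (↭-sym (↭-reverse π)) pπ)

∈-word⁻ : ∀ k {π : List A} {x} → x ∈ word k π → x ∈ π
∈-word⁻ k = All.lookup (All-word k (All.tabulate id))

-- Relabellings

Unique-map⇒injective : ∀ {B : Set} (f : A → B) {xs} → Unique (map f xs) →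
  ∀ {x y} → x ∈ xs → y ∈ xs → f x ≡ f y → x ≡ y
Unique-map⇒injective f (_ ∷ _)  (here refl) (here refl) _  = refl
Unique-map⇒injective f (≢s ∷ _) (here refl) (there y∈)  eq = contradiction eq (All.lookup (All.map⁻ ≢s) y∈)
Unique-map⇒injective f (≢s ∷ _) (there x∈)  (here refl) eq = contradiction (sym eq) (All.lookup (All.map⁻ ≢s) x∈)
Unique-map⇒injective f (_ ∷ u)  (there x∈)  (there y∈)  eq = Unique-map⇒injective f u x∈ y∈ eq

map-injective-on : ∀ {B : Set} (f : A → B) {xs ys} → (∀ {x y} → x ∈ xs → y ∈ ys → f x ≡ f y → x ≡ y) →
  map f xs ≡ map f ys → xs ≡ ys
map-injective-on f {[]}    {[]}    inj eq = refl
map-injective-on f {x ∷ xs} {y ∷ ys} inj eq = cong₂ _∷_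
  (inj (here refl) (here refl) (∷-injectiveˡ eq))
  (map-injective-on f (λ x∈ y∈ → inj (there x∈) (there y∈)) (∷-injectiveʳ eq))

map-++⁻ : ∀ {B : Set} (f : A → B) xs {ys zs} → map f xs ≡ ys ++ zs → ∃ λ us → ∃ λ vs → xs ≡ us ++ vs × map f us ≡ ys
map-++⁻ f xs       {[]}     eq = [] , xs , refl , refl
map-++⁻ f (x ∷ xs) {y ∷ ys} eq with map-++⁻ f xs {ys} (∷-injectiveʳ eq)
... | us , vs , refl , refl = x ∷ us , vs , refl , cong (_∷ map f us) (∷-injectiveˡ eq)

-- The map found for the tail is overridden at the head `x`; as `x` does not recur, the values on
-- the tail survive.
relabelling : ∀ {xs : Seq} → Unique xs → (ys : Seq) → length xs ≡ length ys → ∃ λ f → map f xs ≡ ys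
relabelling []                 []       _  = id , refl
relabelling {x ∷ xs} (x≢ ∷ u) (y ∷ ys) eq with relabelling u ys (suc-injective eq)
... | f , refl = g , cong₂ _∷_ g-x (map-cong-local g-xs)
  where
  g : ℕ → ℕ
  g z with x ≟ z
  ... | yes _ = y
  ... | no  _ = f z
  g-x : g x ≡ y
  g-x with x ≟ x
  ... | yes _  = refl
  ... | no x≢x = contradiction refl x≢x
  g-≢ : ∀ {z} → x ≢ z → g z ≡ f z
  g-≢ {z} x≢z with x ≟ z
  ... | yes x≡z = contradiction x≡z x≢z
  ... | no _    = refl
  g-xs : All (λ z → g z ≡ f z) xs
  g-xs = All.map g-≢ x≢

I-unique : ∀ c → Unique (I c)
I-unique c = Unique.applyUpTo⁺₁ suc c (λ i<j _ → <⇒≢ i<j ∘ suc-injective)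

word⊆⇒Contains : ∀ {w π} k c → Unique π → length π ≡ c → word k π ⊆ w → Contains w (word k (I c))
word⊆⇒Contains {w} {π} k c uniq len τ with relabelling uniq (I c) (trans len (sym (length-applyUpTo suc c)))
... | f , f-π = word k π , τ , f
  , (λ x∈ y∈ → Unique-map⇒injective f (subst Unique (sym f-π) (I-unique c)) (∈-word⁻ k x∈) (∈-word⁻ k y∈))
  , trans (map-word f k π) (cong (word k) f-π)

-- As the exponent is positive, the copy `t` starts with a preimage `π` of `I c`. Then `t` and
-- `word (suc k) π` have the same image under `f`, and injectivity on `t` makes them equal.
Contains⇒word⊆ : ∀ {w} k c → Contains w (word (suc k) (I c)) →
  ∃ λ π → Unique π × length π ≡ c × word (suc k) π ⊆ w
Contains⇒word⊆ {w} k c (t , τ , f , inj , f-t)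
  with map-++⁻ f t (trans f-t (++-assoc (I c) (concat (replicate k (I c))) (D c)))
... | π , rest , refl , f-π = π
  , Unique.map⁻ (subst Unique (sym f-π) (I-unique c))
  , trans (sym (length-map f π)) (trans (cong length f-π) (length-applyUpTo suc c))
  , subst (_⊆ w)
      (map-injective-on f (λ x∈ y∈ → inj x∈ (∈-++⁺ˡ (∈-word⁻ (suc k) {π} y∈)))
        (trans f-t (trans (cong (word (suc k)) (sym f-π)) (sym (map-word f (suc k) π)))))
      τ

-- Erdős–Szekeres

split-All : ∀ {P Q : A → Set} p q {zs} → All (λ z → P z ⊎ Q z) zs → p + q ≤ length zs →
  (∃ λ N → N ⊆ zs × All P N × p ≤ length N) ⊎ (∃ λ N → N ⊆ zs × All Q N × q ≤ length N)
split-All zero    q       _  _ = inj₁ ([] , minimum _ , [] , z≤n)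
split-All (suc p) zero    _  _ = inj₂ ([] , minimum _ , [] , z≤n)
split-All (suc p) (suc q) {z ∷ zs} (inj₁ pz ∷ pqs) (s≤s le) = Sum.map
  (λ (N , τ , ps , l) → z ∷ N , refl ∷ τ , pz ∷ ps , s≤s l)
  (λ (N , τ , qs , l) → N , z ∷ʳ τ , qs , l)
  (split-All p (suc q) pqs le)
split-All (suc p) (suc q) {z ∷ zs} (inj₂ qz ∷ pqs) (s≤s le) = Sum.map
  (λ (N , τ , ps , l) → N , z ∷ʳ τ , ps , l)
  (λ (N , τ , qs , l) → z ∷ N , refl ∷ τ , qz ∷ qs , s≤s l)
  (split-All (suc p) q pqs (subst (_≤ length zs) (+-suc p q) le))

-- By Pascal's rule this is the binomial coefficient C(a + b, a) minus 1.
esBound : ℕ → ℕ → ℕ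
esBound zero    b       = 0
esBound (suc a) zero    = 0
esBound (suc a) (suc b) = suc (esBound a (suc b) + esBound (suc a) b)

-- With x the head of xs and ys = ys₁ ++ x ∷ ys₂, the other letters of xs lie after x in ys (x is then put before
-- a common sublist) or before it (x is then put at the end of a reversed one).
erdős–szekeres : ∀ a b {xs ys : List A} → Unique xs → All (_∈ ys) xs → esBound a b ≤ length xs →
  (∃ λ M → M ⊆ xs × length M ≡ a × M ⊆ ys) ⊎ (∃ λ M → M ⊆ xs × length M ≡ b × reverse M ⊆ ys)
erdős–szekeres zero    b    _ _ _ = inj₁ ([] , minimum _ , refl , minimum _)
erdős–szekeres (suc a) zero _ _ _ = inj₂ ([] , minimum _ , refl , minimum _)
erdős–szekeres (suc a) (suc b) {x ∷ xs} (x≢ ∷ u) (x∈ ∷ xs∈) (s≤s le) with ∈-∃++ x∈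
... | ys₁ , ys₂ , refl with split-All (esBound a (suc b)) (esBound (suc a) b) (All.zipWith sides (x≢ , xs∈)) le
  where
  sides : ∀ {z} → x ≢ z × z ∈ ys₁ ++ x ∷ ys₂ → z ∈ ys₂ ⊎ z ∈ ys₁
  sides (x≢z , z∈) with ∈-++⁻ ys₁ z∈
  ... | inj₁ z∈ys₁         = inj₂ z∈ys₁
  ... | inj₂ (here z≡x)    = contradiction (sym z≡x) x≢z
  ... | inj₂ (there z∈ys₂) = inj₁ z∈ys₂
... | inj₁ (N , N⊆xs , N∈ys₂ , l) = Sum.map
  (λ (M , M⊆N , len , M⊆ys₂) → x ∷ M , refl ∷ ⊆-trans M⊆N N⊆xs , cong suc len , ++⁺ˡ ys₁ (refl ∷ M⊆ys₂))
  (λ (M , M⊆N , len , M⊆ys₂) → M , x ∷ʳ ⊆-trans M⊆N N⊆xs , len , ++⁺ˡ ys₁ (x ∷ʳ M⊆ys₂))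
  (erdős–szekeres a (suc b) (AllPairs-resp-⊇ N⊆xs u) N∈ys₂ l)
... | inj₂ (N , N⊆xs , N∈ys₁ , l) = Sum.map
  (λ (M , M⊆N , len , M⊆ys₁) → M , x ∷ʳ ⊆-trans M⊆N N⊆xs , len , ++⁺ʳ (x ∷ ys₂) M⊆ys₁)
  (λ (M , M⊆N , len , M⊆ys₁) → x ∷ M , refl ∷ ⊆-trans M⊆N N⊆xs , cong suc len ,
    subst (_⊆ ys₁ ++ x ∷ ys₂) (sym (unfold-reverse x M)) (++⁺ M⊆ys₁ (refl ∷ minimum ys₂)))
  (erdős–szekeres (suc a) b (AllPairs-resp-⊇ N⊆xs u) N∈ys₁ l)

Oriented : List A → List A → Set
Oriented M B = M ⊆ B ⊎ reverse M ⊆ B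

Oriented-resp-⊇ : ∀ {M N B : List A} → M ⊆ N → Oriented N B → Oriented M B
Oriented-resp-⊇ τ = Sum.map (⊆-trans τ) (⊆-trans (reverse⁺ τ))

iterBound : ℕ → ℕ → ℕ
iterBound zero    n = n
iterBound (suc s) n = iterBound s (esBound n n)

-- The blocks in `bs` are treated first and leave `esBound n n` letters, enough for one more
-- Erdős-Szekeres step against `B`. Passing to a sublist preserves the orientations already
-- obtained.
oriented-sublist : ∀ n {L : List A} → Unique L → ∀ bs → length L ≡ iterBound (length bs) n → All (_↭ L) bs →
  ∃ λ M → M ⊆ L × length M ≡ n × All (Oriented M) bs
oriented-sublist n {L} u []       len []       = L , ⊆-refl , len , []
oriented-sublist n {L} u (B ∷ bs) len (p ∷ ps) with oriented-sublist (esBound n n) u bs len ps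
... | N , N⊆L , lenN , os with erdős–szekeres n n (AllPairs-resp-⊇ N⊆L u)
        (All.tabulate (λ x∈N → ∈-resp-↭ (↭-sym p) (Any-resp-⊆ N⊆L x∈N))) (≤-reflexive (sym lenN))
... | inj₁ (M , M⊆N , lenM , M⊆B) =
  M , ⊆-trans M⊆N N⊆L , lenM , inj₁ M⊆B ∷ All.map (Oriented-resp-⊇ M⊆N) os
... | inj₂ (M , M⊆N , lenM , M⊆B) =
  M , ⊆-trans M⊆N N⊆L , lenM , inj₂ M⊆B ∷ All.map (Oriented-resp-⊇ M⊆N) os

-- The upper bound

-- The i-th letter is taken from the i-th block, so the order inside a block is irrelevant.
one-letter-per-block : ∀ {xs : List A} {bs} → length xs ≤ length bs → All (λ B → All (_∈ B) xs) bs → xs ⊆ concat bs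
one-letter-per-block {xs = []}     _        _                   = minimum _
one-letter-per-block {xs = x ∷ xs} (s≤s le) ((x∈B ∷ _) ∷ cover) =
  ++⁺ (from∈ x∈B) (one-letter-per-block le (All.map All.tail cover))

⊆⇒All∈ : ∀ {M N B : List A} → M ↭ N → N ⊆ B → All (_∈ B) M
⊆⇒All∈ p τ = All-resp-↭ (↭-sym p) (All.tabulate (Any-resp-⊆ τ))

++-replicate-⊆ : ∀ p {X Y B W : List A} → X ⊆ B → concat (replicate p X) ++ Y ⊆ W →
  concat (replicate (suc p) X) ++ Y ⊆ B ++ W
++-replicate-⊆ p {X} {Y} τ σ = subst (_⊆ _) (sym (++-assoc X (concat (replicate p X)) Y)) (++⁺ τ σ)

-- Among p + q + 1 blocks, either p + 1 contain `M` or q + 1 contain `N`. The `length M` blocks left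
-- over contain all letters of both lists, whatever their orientation, and spell the other list
-- letter by letter.
majority : ∀ p q {M N : List A} {bs} → M ↭ N → All (λ B → M ⊆ B ⊎ N ⊆ B) bs → suc (p + q + length M) ≤ length bs →
  concat (replicate (suc p) M) ++ N ⊆ concat bs ⊎ concat (replicate (suc q) N) ++ M ⊆ concat bs
majority zero q {M} {N} M↭N (inj₁ M⊆B ∷ os) (s≤s le) =
  inj₁ (++-replicate-⊆ 0 M⊆B (one-letter-per-block
    (≤-trans (≤-reflexive (sym (↭-length M↭N))) (≤-trans (m≤n+m (length M) q) le))
    (All.map Sum.[ ⊆⇒All∈ (↭-sym M↭N) , ⊆⇒All∈ ↭-refl ] os)))
majority (suc p) q M↭N (inj₁ M⊆B ∷ os) (s≤s le) =
  Sum.map (++-replicate-⊆ (suc p) M⊆B) (++⁺ˡ _) (majority p q M↭N os le)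
majority p zero {M} {N} M↭N (inj₂ N⊆B ∷ os) (s≤s le) =
  inj₂ (++-replicate-⊆ 0 N⊆B (one-letter-per-block
    (≤-trans (m≤n+m (length M) (p + 0)) le)
    (All.map Sum.[ ⊆⇒All∈ ↭-refl , ⊆⇒All∈ M↭N ] os)))
majority p (suc q) {M} {N} {B ∷ bs} M↭N (inj₂ N⊆B ∷ os) (s≤s le) =
  Sum.map (++⁺ˡ _) (++-replicate-⊆ (suc q) N⊆B)
    (majority p q M↭N os (subst (λ n → n + length M ≤ length bs) (+-suc p q) le))

-- For exponent k + 1 the width is (2k + 1) + c: the first 2k + 1 blocks yield k + 1 equally
-- oriented ones, and c blocks remain.
forces : ∀ c k → FormationForces (word (suc k) (I c)) (suc (k + k + c))
forces c k = iterBound (suc (k + k + c)) c , forced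
  where
  forced : ∀ w → IsFormation (iterBound (suc (k + k + c)) c) (suc (k + k + c)) w → Contains w (word (suc k) (I c))
  forced w (L , uniq , lenL , bs , lenBs , ps , refl)
    with oriented-sublist c uniq bs (trans lenL (cong (λ s → iterBound s c) (sym lenBs))) ps
  ... | M , M⊆L , lenM , os
    with majority k k (↭-sym (↭-reverse M)) os
           (≤-reflexive (trans (cong (λ n → suc (k + k + n)) lenM) (sym lenBs)))
  ... | inj₁ τ = word⊆⇒Contains (suc k) c (AllPairs-resp-⊇ M⊆L uniq) lenM τ
  -- Here `π` is `reverse M`, and the closing `M` is its reversal.
  ... | inj₂ τ = word⊆⇒Contains (suc k) c
    (Unique-resp-↭ (↭⇒↭ₛ (↭-sym (↭-reverse M))) (AllPairs-resp-⊇ M⊆L uniq))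
    (trans (length-reverse M) lenM)
    (subst (λ N → concat (replicate (suc k) (reverse M)) ++ N ⊆ concat bs) (sym (reverse-involutive M)) τ)

-- The lower bound

-- Once `x` is matched inside `xs`, all later letters of `xs` are `R`-related to it, so `y` must be
-- matched in `ws`.
first-or-rest : ∀ {R : A → A → Set} {x y vs xs ws} → AllPairs R xs → ¬ R x y →
  x ∷ y ∷ vs ⊆ xs ++ ws → y ∷ vs ⊆ ws
first-or-rest {xs = []}     _        ¬Rxy τ          = ∷ˡ⁻ τ
first-or-rest {xs = _ ∷ xs} (_ ∷ rs) ¬Rxy (_ ∷ʳ τ)   = first-or-rest rs ¬Rxy τ
first-or-rest {R = R} {x} {xs = _ ∷ xs} (r ∷ _) ¬Rxy (refl ∷ τ) = skip {R = R x} r ¬Rxy τ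
  where
  skip : ∀ {A : Set} {R : A → Set} {y vs xs ws} → All R xs → ¬ R y → y ∷ vs ⊆ xs ++ ws → y ∷ vs ⊆ ws
  skip []       ¬Ry τ          = τ
  skip (_ ∷ rs) ¬Ry (_ ∷ʳ τ)   = skip rs ¬Ry τ
  skip (r ∷ _)  ¬Ry (refl ∷ _) = contradiction r ¬Ry

-- Counting non-ascents

nonAscent : ℕ → ℕ → ℕ
nonAscent x y with x <? y
... | yes _ = 0
-- Equal letters count too, as in the middle of `π ++ reverse π`.
... | no  _ = 1

nonAscents : Seq → ℕ
nonAscents []           = 0
nonAscents (x ∷ [])     = 0
nonAscents (x ∷ y ∷ xs) = nonAscent x y + nonAscents (y ∷ xs)

nonAscents-< : ∀ m x xs {U} → AllPairs _<_ U → x ∷ xs ⊆ concat (replicate m U) → nonAscents (x ∷ xs) < m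
nonAscents-< (suc m) x []       inc τ = s≤s z≤n
nonAscents-< m x (y ∷ xs) inc τ with x <? y
... | yes _ = nonAscents-< m y xs inc (∷ˡ⁻ τ)
nonAscents-< (suc m) x (y ∷ xs) inc τ | no x≮y = s≤s (nonAscents-< m y xs inc (first-or-rest inc x≮y τ))

-- Both parts share the letter `y`, so each adjacent pair is counted once.
nonAscents-++ : ∀ xs y ys → nonAscents (xs ++ y ∷ ys) ≡ nonAscents (xs ++ y ∷ []) + nonAscents (y ∷ ys)
nonAscents-++ []            y ys = refl
nonAscents-++ (x ∷ [])      y ys = cong (_+ nonAscents (y ∷ ys)) (sym (+-identityʳ (nonAscent x y)))
nonAscents-++ (x ∷ x′ ∷ xs) y ys =
  trans (cong (nonAscent x x′ +_) (nonAscents-++ (x′ ∷ xs) y ys)) (sym (+-assoc (nonAscent x x′) _ _))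

nonAscent-≢ : ∀ {x y} → x ≢ y → nonAscent x y + nonAscent y x ≡ 1
nonAscent-≢ {x} {y} x≢y with x <? y | y <? x
... | yes x<y | yes y<x = contradiction y<x (<-asym x<y)
... | yes _   | no  _   = refl
... | no  _   | yes _   = refl
... | no x≮y  | no y≮x  = contradiction (≤-antisym (≮⇒≥ y≮x) (≮⇒≥ x≮y)) x≢y

-- Each adjacent pair of `π` occurs once in either order, and exactly one of the two is a
-- non-ascent; the doubled last letter adds one more. The induction peels `x` off both ends.
nonAscents-palindrome : ∀ {π} → Unique π → nonAscents (π ++ reverse π) ≡ length π
nonAscents-palindrome {[]}        _ = refl
nonAscents-palindrome {x ∷ []}    _ with x <? x
... | yes x<x = contradiction x<x (n≮n x)
... | no  _   = refl
nonAscents-palindrome {x ∷ y ∷ π} ((x≢y ∷ _) ∷ uniq) = begin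
  nonAscents (x ∷ y ∷ π ++ reverse (x ∷ y ∷ π))
    ≡⟨ cong nonAscents (trans (cong (λ ys → x ∷ y ∷ π ++ ys) (unfold-reverse x (y ∷ π)))
         (trans (cong (λ ys → x ∷ y ∷ π ++ ys ++ x ∷ []) (unfold-reverse y π)) (reassoc π (reverse π)))) ⟩
  nonAscent x y + nonAscents ((y ∷ π ++ reverse π) ++ y ∷ x ∷ [])
    ≡⟨ cong (nonAscent x y +_) (nonAscents-++ (y ∷ π ++ reverse π) y (x ∷ [])) ⟩
  nonAscent x y + (nonAscents ((y ∷ π ++ reverse π) ++ y ∷ []) + (nonAscent y x + 0))
    ≡⟨ cong (λ zs → nonAscent x y + (nonAscents zs + (nonAscent y x + 0)))
         (trans (++-assoc (y ∷ π) (reverse π) (y ∷ [])) (cong (λ ys → y ∷ π ++ ys) (sym (unfold-reverse y π)))) ⟩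
  nonAscent x y + (nonAscents (y ∷ π ++ reverse (y ∷ π)) + (nonAscent y x + 0))
    ≡⟨ cong₂ (λ m n → nonAscent x y + (m + n)) (nonAscents-palindrome uniq) (+-identityʳ _) ⟩
  nonAscent x y + (length (y ∷ π) + nonAscent y x)
    ≡⟨ cong (nonAscent x y +_) (+-comm (length (y ∷ π)) _) ⟩
  nonAscent x y + (nonAscent y x + length (y ∷ π))
    ≡⟨ +-assoc (nonAscent x y) _ _ ⟨
  nonAscent x y + nonAscent y x + length (y ∷ π)
    ≡⟨ cong (_+ length (y ∷ π)) (nonAscent-≢ x≢y) ⟩
  length (x ∷ y ∷ π) ∎
  where
  open ≡-Reasoning
  reassoc : ∀ (us vs : Seq) →
    x ∷ y ∷ us ++ (vs ++ y ∷ []) ++ x ∷ [] ≡ x ∷ (y ∷ us ++ vs) ++ y ∷ x ∷ []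
  reassoc us vs = cong (λ zs → x ∷ y ∷ zs)
    (trans (cong (us ++_) (++-assoc vs (y ∷ []) (x ∷ []))) (sym (++-assoc us vs _)))

-- Alternating increasing and decreasing blocks

zigzag : {A : Set} → ℕ → ℕ → List A → List A → List (List A)
zigzag zero    m U V = replicate m U
zigzag (suc k) m U V = U ∷ V ∷ zigzag k m U V

length-zigzag : ∀ k m (U V : List A) → length (zigzag k m U V) ≡ k + k + m
length-zigzag zero    m U V = length-replicate m
length-zigzag (suc k) m U V =
  cong suc (trans (cong suc (length-zigzag k m U V)) (cong (_+ m) (sym (+-suc k k))))

All-zigzag : ∀ {P : List A → Set} k m {U V} → P U → P V → All P (zigzag k m U V)
All-zigzag zero    m pU pV = All.replicate⁺ m pU
All-zigzag (suc k) m pU pV = pU ∷ pV ∷ All-zigzag k m pU pV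

pairs : A → A → ℕ → List A → List A
pairs a b zero    vs = vs
pairs a b (suc k) vs = a ∷ b ∷ pairs a b k vs

-- Every copy of `a ∷ b ∷ π` but the last is cut down to its first two letters.
pairs-⊆-word : ∀ k (a b : A) π →
  pairs a b (suc k) (π ++ reverse (a ∷ b ∷ π)) ⊆ word (suc k) (a ∷ b ∷ π)
pairs-⊆-word zero    a b π = ⊆-reflexive (cong (_++ reverse (a ∷ b ∷ π)) (sym (++-identityʳ (a ∷ b ∷ π))))
pairs-⊆-word (suc k) a b π = subst (pairs a b (suc (suc k)) (π ++ reverse (a ∷ b ∷ π)) ⊆_)
  (sym (++-assoc (a ∷ b ∷ π) (concat (replicate (suc k) (a ∷ b ∷ π))) _))
  (++⁺ (refl ∷ refl ∷ minimum π) (pairs-⊆-word k a b π))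

module _ {U V : Seq} (inc : AllPairs _<_ U) (dec : AllPairs _>_ V) where

  -- `U` cannot hold `a b`, nor `V` hold `b a`, so each `U V` absorbs at most one pair.
  pairs-⊆-zigzag-> : ∀ {a b} k m {vs} → b < a → pairs a b (suc k) vs ⊆ concat (zigzag k m U V) →
    a ∷ b ∷ vs ⊆ concat (replicate m U)
  pairs-⊆-zigzag-> zero    m b<a τ = τ
  pairs-⊆-zigzag-> (suc k) m b<a τ = pairs-⊆-zigzag-> k m b<a
    (first-or-rest dec (<-asym b<a) (first-or-rest inc (<-asym b<a) τ))

  -- The blocks regroup as (V U)^k V U^m. Each `V U` absorbs at most one pair, and the last `V` at
  -- most the letter `a`.
  pairs-⊆-zigzag-< : ∀ {a b} k m {vs} → a < b → pairs a b (suc k) vs ⊆ V ++ concat (zigzag k m U V) →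
    b ∷ vs ⊆ concat (replicate m U)
  pairs-⊆-zigzag-< zero    m a<b τ = first-or-rest dec (<-asym a<b) τ
  pairs-⊆-zigzag-< (suc k) m a<b τ = pairs-⊆-zigzag-< k m a<b
    (first-or-rest inc (<-asym a<b) (first-or-rest dec (<-asym a<b) τ))

  word-⊈-zigzag : ∀ k {π} → Unique π → 2 ≤ length π → ¬ word (suc k) π ⊆ concat (zigzag k (length π) U V)
  word-⊈-zigzag k {a ∷ []} _ (s≤s ()) _
  word-⊈-zigzag k {a ∷ b ∷ π} uniq@((a≢b ∷ _) ∷ _) _ τ
    with <-cmp a b | ⊆-trans (pairs-⊆-word k a b π) τ
  ... | tri≈ _ a≡b _ | _ = a≢b a≡b
  ... | tri> _ _ b<a | σ = n≮n (length (a ∷ b ∷ π))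
    (subst (_< length (a ∷ b ∷ π)) (nonAscents-palindrome uniq)
      (nonAscents-< _ a _ inc (pairs-⊆-zigzag-> k _ b<a σ)))
  ... | tri< a<b _ _ | σ = n≮n (length (a ∷ b ∷ π))
    (subst (_< length (a ∷ b ∷ π)) (trans (sym nonAscents-tail) (nonAscents-palindrome uniq))
      (nonAscents-< _ b (π ++ reverse (a ∷ b ∷ π)) inc (tail-⊆ k σ)))
    where
    -- Losing the first `a` leaves the count unchanged, since `a b` is an ascent.
    nonAscents-tail : nonAscents (a ∷ b ∷ π ++ reverse (a ∷ b ∷ π)) ≡ nonAscents (b ∷ π ++ reverse (a ∷ b ∷ π))
    nonAscents-tail with a <? b
    ... | yes _   = refl
    ... | no a≮b = contradiction a<b a≮b
    tail-⊆ : ∀ k {m vs} → pairs a b (suc k) vs ⊆ concat (zigzag k m U V) → b ∷ vs ⊆ concat (replicate m U)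
    tail-⊆ zero        σ = ∷ˡ⁻ σ
    -- The first `U` may hold the first `a b` but not the next `a`; the other pairs therefore embed
    -- from the first `V` on.
    tail-⊆ (suc k) {m} σ = pairs-⊆-zigzag-< k m a<b (first-or-rest inc (<-asym a<b) (∷ˡ⁻ σ))

concat-take-⊆ : ∀ n (xss : List (List A)) → concat (take n xss) ⊆ concat xss
concat-take-⊆ n xss = ⊆-trans (++⁺ʳ (concat (drop n xss)) ⊆-refl)
  (⊆-reflexive (trans (concat-++ (take n xss) (drop n xss)) (cong concat (take++drop≡id n xss))))

-- For any `r`, the first `s` blocks of the zigzag on 0, ..., r - 1 form a formation; a copy inside
-- them would also lie in the whole zigzag.
not-forces : ∀ c k s → 2 ≤ c → s ≤ k + k + c → ¬ FormationForces (word (suc k) (I c)) s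
not-forces c k s 2≤c s≤ (r , forced)
  with Contains⇒word⊆ k c (forced (concat (take s blocks))
    ( upTo r , Unique.upTo⁺ r , length-upTo r , take s blocks
    , trans (length-take s blocks) (m≤n⇒m⊓n≡m (≤-trans s≤ (≤-reflexive (sym (length-zigzag k c _ _)))))
    , All.take⁺ s (All-zigzag k c ↭-refl downFrom↭upTo) , refl))
  where
  blocks : List Seq
  blocks = zigzag k c (upTo r) (downFrom r)
  downFrom↭upTo : downFrom r ↭ upTo r
  downFrom↭upTo = ↭-trans (↭-reflexive (sym (reverse-upTo r))) (↭-reverse (upTo r))
... | π , uniq , refl , τ = word-⊈-zigzag
  (AllPairs.applyUpTo⁺₁ id r (λ i<j _ → i<j)) (AllPairs.applyDownFrom⁺₁ id r (λ j<i _ → j<i))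
  k uniq 2≤c (⊆-trans τ (concat-take-⊆ s _))

theorem5p4 : (c k : ℕ) → 2 ≤ c → 1 ≤ k → FwEq (Ipow c k ++ D c) (c + 2 * k ∸ 1)
theorem5p4 c (suc k) 2≤c _ = subst (FwEq (Ipow c (suc k) ++ D c)) (sym width)
  (forces c k , λ s s< → not-forces c k s 2≤c (≤-pred s<))
  where
  width : c + 2 * suc k ∸ 1 ≡ suc (k + k + c)
  width = begin
    c + (suc k + (suc k + 0)) ∸ 1 ≡⟨ cong (_∸ 1) (+-comm c _) ⟩
    k + (suc k + 0) + c           ≡⟨ cong (λ n → k + n + c) (+-identityʳ (suc k)) ⟩
    k + suc k + c                 ≡⟨ cong (_+ c) (+-suc k k) ⟩
    suc (k + k + c)               ∎
    where open ≡-Reasoning
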